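{- For every finite graph $G$ and every integer $k$ with $1\le k<|V(G)|$, the graphs $C(F_k(G))$ and $F_k(C(G))$, both of which have as vertex set the set of $k$-element subsets of $V(G)$, are equal: $C(F_k(G))=F_k(C(G))$.
   Context: All graphs are finite, simple and undirected; edges are regarded as 2-element subsets of the vertex set, and $N_G(u)$ denotes the set of neighbors of $u$ in $G$. For a graph $G$ and an integer $k$ with $1\le k<|V(G)|$, the $k$-token graph $F_k(G)$ is the graph whose vertices are the $k$-element subsets of $V(G)$, with two such subsets $A,B$ adjacent if and only if their symmetric difference $A\triangle B$ is an edge of $G$ (in particular $|A\triangle B|=2$). For any graph $G$, a pair $\{u,v\}$ of distinct vertices of $G$ is called admissible if $|N_G(u)\cap N_G(v)|\ge 5$; $A(G)$ denotes the set of all admissible pairs of $G$. The admissible augmentation of $G$ is the graph $C(G)=(V(G),E(G)\cup A(G))$. -}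

module Defs where

open import Data.Bool.Properties using () renaming (_≟_ to _≟ᵇ_)
open import Data.Fin using (Fin; zero; suc)
open import Data.Fin.Properties using (any?; +↔⊎) renaming (_≟_ to _≟ᶠ_)
open import Data.Fin.Subset using (Subset; inside; outside; ⊥; ⁅_⁆; _∪_; _∩_; _─_; ∣_∣; _∈_)
open import Data.Fin.Subset.Properties using (∪-comm; ∩-comm; ∪-idem; x∈⁅x⁆; x∈p∪q⁺; ∉⊥; ∣⊥∣≡0)
open import Data.Nat using (ℕ; zero; suc; _≤_; _≤?_)
open import Data.Nat.Combinatorics using (nCk+nC[k+1]≡[n+1]C[k+1]) renaming (_C_ to _choose_)
open import Data.Nat.Properties using (≡-irrelevant; suc-injective)
open import Data.Product using (∃-syntax; Σ-syntax; _×_; _,_; proj₁)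
open import Data.Sum using (_⊎_; inj₁; inj₂)
open import Data.Sum.Function.Propositional using (_⊎-↔_)
open import Data.Vec using ([]; _∷_; tabulate)
open import Data.Vec.Properties using (≡-dec)
open import Function using (_∘_)
open import Function.Bundles using (_↔_; _⇔_; Inverse; mk↔ₛ′)
open import Function.Properties.Inverse using (↔-sym; ↔-trans; ↔⇒↣)
open import Relation.Binary using (Rel; Symmetric; Decidable; DecidableEquality)
open import Relation.Binary.PropositionalEquality using (_≡_; _≢_; refl; sym; trans; cong; subst)
open import Relation.Nullary using (¬_; does; ¬?; _×-dec_; _⊎-dec_)
open import Relation.Nullary.Decidable using (via-injection)
open import Level using (0ℓ)

record FinSet : Set₁ where
  field
    Carrier : Set
    size    : ℕ
    enum    : Carrier ↔ Fin size

  elem : Fin size → Carrier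
  elem = Inverse.from enum

  _≟_ : DecidableEquality Carrier
  _≟_ = via-injection (↔⇒↣ enum) _≟ᶠ_

-- A subset of X is given by the set of indices of its elements.
SubsetOf : FinSet → Set
SubsetOf X = Subset (FinSet.size X)

infixl 6 _△_

_△_ : ∀ {n} → Subset n → Subset n → Subset n
p △ q = (p ─ q) ∪ (q ─ p)

△-comm : ∀ {n} (p q : Subset n) → p △ q ≡ q △ p
△-comm p q = ∪-comm (p ─ q) (q ─ p)

p─p≡⊥ : ∀ {n} (p : Subset n) → p ─ p ≡ ⊥
p─p≡⊥ []            = refl
p─p≡⊥ (inside  ∷ p) = cong (outside ∷_) (p─p≡⊥ p)
p─p≡⊥ (outside ∷ p) = cong (outside ∷_) (p─p≡⊥ p)

p△p≡⊥ : ∀ {n} (p : Subset n) → p △ p ≡ ⊥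
p△p≡⊥ p = trans (∪-idem (p ─ p)) (p─p≡⊥ p)

⁅i⁆∪⁅j⁆≢⊥ : ∀ {n} (i j : Fin n) → ⁅ i ⁆ ∪ ⁅ j ⁆ ≢ ⊥
⁅i⁆∪⁅j⁆≢⊥ i j eq = ∉⊥ (subst (i ∈_) eq (x∈p∪q⁺ (inj₁ (x∈⁅x⁆ i))))

KSub : ℕ → ℕ → Set
KSub n k = Σ[ p ∈ Subset n ] ∣ p ∣ ≡ k

KSub-≡ : ∀ {n k} {A B : KSub n k} → proj₁ A ≡ proj₁ B → A ≡ B
KSub-≡ {A = p , e} {B = .p , e′} refl = cong (p ,_) (≡-irrelevant e e′)

∣p∣≡0⇒p≡⊥ : ∀ {n} (p : Subset n) → ∣ p ∣ ≡ 0 → p ≡ ⊥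
∣p∣≡0⇒p≡⊥ []            _ = refl
∣p∣≡0⇒p≡⊥ (outside ∷ p) e = cong (outside ∷_) (∣p∣≡0⇒p≡⊥ p e)

KSub-pascal : ∀ n k → KSub (suc n) (suc k) ↔ (KSub n k ⊎ KSub n (suc k))
KSub-pascal n k = mk↔ₛ′ to from to-from from-to
  where
  to : KSub (suc n) (suc k) → KSub n k ⊎ KSub n (suc k)
  to (inside  ∷ p , e) = inj₁ (p , suc-injective e)
  to (outside ∷ p , e) = inj₂ (p , e)

  from : KSub n k ⊎ KSub n (suc k) → KSub (suc n) (suc k)
  from (inj₁ (p , e)) = inside  ∷ p , cong suc e
  from (inj₂ (p , e)) = outside ∷ p , e

  to-from : ∀ x → to (from x) ≡ x
  to-from (inj₁ _) = cong inj₁ (KSub-≡ refl)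
  to-from (inj₂ _) = refl

  from-to : ∀ x → from (to x) ≡ x
  from-to (inside  ∷ p , e) = KSub-≡ refl
  from-to (outside ∷ p , e) = refl

-- Finiteness of the set of k-subsets, so that N and C also make sense for token graphs.
KSub-enum : ∀ n k → KSub n k ↔ Fin (n choose k)
KSub-enum n zero = mk↔ₛ′ (λ _ → zero) (λ _ → ⊥ , ∣⊥∣≡0 n)
  (λ { zero → refl }) (λ { (p , e) → KSub-≡ (sym (∣p∣≡0⇒p≡⊥ p e)) })
KSub-enum zero (suc k) = mk↔ₛ′ (λ { ([] , ()) }) (λ ()) (λ ()) (λ { ([] , ()) })
KSub-enum (suc n) (suc k) =
  subst (λ m → KSub (suc n) (suc k) ↔ Fin m) (nCk+nC[k+1]≡[n+1]C[k+1] n k)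
    (↔-trans (KSub-pascal n k)
      (↔-trans (KSub-enum n k ⊎-↔ KSub-enum n (suc k)) (↔-sym +↔⊎)))

kSubsets : ℕ → FinSet → FinSet
kSubsets k X = record
  { Carrier = KSub size k
  ; size    = size choose k
  ; enum    = KSub-enum size k
  }
  where open FinSet X

record Graph (X : FinSet) : Set₁ where
  open FinSet X
  field
    _~_      : Rel Carrier 0ℓ
    _~?_     : Decidable _~_
    ~-sym    : Symmetric _~_
    ~-irrefl : ∀ {u} → ¬ (u ~ u)

  N : Carrier → SubsetOf X
  N u = tabulate (λ i → does (u ~? elem i))

  -- The indices i and j are distinct by ~-irrefl, so an edge has two elements.
  IsEdge : SubsetOf X → Set
  IsEdge p = ∃[ i ] ∃[ j ] (elem i ~ elem j × p ≡ ⁅ i ⁆ ∪ ⁅ j ⁆)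

  Admissible : Rel Carrier 0ℓ
  Admissible u v = u ≢ v × 5 ≤ ∣ N u ∩ N v ∣

-- Equality of graphs on the same vertex set: equality of their edge sets.
infix 4 _≗ᴳ_

_≗ᴳ_ : ∀ {X} → Graph X → Graph X → Set
_≗ᴳ_ {X} G H = ∀ (u v : FinSet.Carrier X) → (Graph._~_ G u v ⇔ Graph._~_ H u v)

-- The k-token graph.
F : ∀ {X} (k : ℕ) → Graph X → Graph (kSubsets k X)
F {X} k G = record
  { _~_      = λ A B → IsEdge (proj₁ A △ proj₁ B)
  ; _~?_     = λ A B → any? λ i → any? λ j →
                 (elem i ~? elem j) ×-dec ≡-dec _≟ᵇ_ (proj₁ A △ proj₁ B) (⁅ i ⁆ ∪ ⁅ j ⁆)
  ; ~-sym    = λ { {A} {B} (i , j , i~j , eq) →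
                 i , j , i~j , trans (△-comm (proj₁ B) (proj₁ A)) eq }
  ; ~-irrefl = λ { {A} (i , j , _ , eq) →
                 ⁅i⁆∪⁅j⁆≢⊥ i j (trans (sym eq) (p△p≡⊥ (proj₁ A))) }
  }
  where
  open FinSet X
  open Graph G

-- The admissible augmentation (V(G), E(G) ∪ A(G)).
C : ∀ {X} → Graph X → Graph X
C {X} G = record
  { _~_      = λ u v → u ~ v ⊎ Admissible u v
  ; _~?_     = λ u v → (u ~? v) ⊎-dec (¬? (u ≟ v) ×-dec (5 ≤? ∣ N u ∩ N v ∣))
  ; ~-sym    = λ { (inj₁ u~v) → inj₁ (~-sym u~v)
                 ; {u} {v} (inj₂ (u≢v , 5≤)) →
                     inj₂ (u≢v ∘ sym , subst (λ p → 5 ≤ ∣ p ∣) (∩-comm (N u) (N v)) 5≤) }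
  ; ~-irrefl = λ { (inj₁ u~u) → ~-irrefl u~u ; (inj₂ (u≢u , _)) → u≢u refl }
  }
  where
  open FinSet X
  open Graph G

{-# OPTIONS --safe #-}

-- Adjacency of k-sets A, B in a token graph means that one token moves along an
-- edge: B = A − i + j with i ∈ A, j ∉ A.  A common neighbour D of A and B is
-- A − x + y = B − z + w.
--
-- If x ≠ z and y ≠ w then |A △ B| = 4, and D is obtained from A by exchanging one
-- of the two elements of A ∖ B with one of the two elements of B ∖ A; so there are
-- at most 4 common neighbours.  Hence an admissible pair satisfies B = A − i + j,
-- and then D is either A − v + j (when v ∈ A) or A − i + v (when v ∉ A) for a common
-- neighbour v of i and j in G.  This is a bijection between the common neighbours
-- of i and j in G and those of A and B in the token graph.
module Submission where

open import Defs
open import Data.Bool using (true; false; _∧_; _∨_; _xor_)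
open import Data.Bool.Properties using (∨-zeroʳ; xor-same)
open import Data.Fin using (Fin; zero; suc; inject≤; combine)
open import Data.Fin.Properties using (_≟_; suc-injective; inject≤-injective; injective⇒≤; pigeonhole; combine-injective; <⇒≢)
open import Data.Fin.Subset using (Subset; inside; outside; ⁅_⁆; _∪_; _∩_; ∣_∣; _∈_)
open import Data.Fin.Subset.Properties using (x∈⁅x⁆; x∈⁅y⁆⇒x≡y; p⊂q⇒∣p∣<∣q∣)
open import Data.Nat using (ℕ; suc; _≤_; _<_)
open import Data.Nat.Properties using (≤-refl; <-irrefl)
open import Data.Product using (∃-syntax; Σ-syntax; _×_; _,_; proj₁; proj₂)
open import Data.Sum using (_⊎_; inj₁; inj₂)
open import Data.Vec using (_∷_; here; there; lookup; _[_]≔_)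
open import Data.Vec.Properties using ([]=⇒lookup; lookup⇒[]=; lookup-zipWith; lookup∘tabulate; tabulate∘lookup; tabulate-cong; lookup∘update; lookup∘update′)
open import Function using (_∘_)
open import Function.Bundles using (mk⇔; Inverse; Injection)
open import Function.Definitions using (Injective)
open import Function.Properties.Inverse using (↔-sym; ↔⇒↣)
open import Relation.Binary.PropositionalEquality using (_≡_; _≢_; refl; sym; trans; cong; cong₂; subst; subst₂; ≢-sym)
open import Relation.Nullary using (¬_; yes; no; does; contradiction)
open import Relation.Nullary.Decidable using (dec-true)

private
  variable
    n m : ℕ
    p q A B D D′ : Subset n
    i j u v x y z w : Fin n

-- Subsets

lookup-ext : (∀ u → lookup p u ≡ lookup q u) → p ≡ q
lookup-ext {p = p} {q = q} eq =
  trans (sym (tabulate∘lookup p)) (trans (tabulate-cong eq) (tabulate∘lookup q))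

lookup-△ : (p q : Subset n) (u : Fin n) → lookup (p △ q) u ≡ lookup p u xor lookup q u
lookup-△ (true  ∷ p) (true  ∷ q) zero = refl
lookup-△ (true  ∷ p) (false ∷ q) zero = refl
lookup-△ (false ∷ p) (true  ∷ q) zero = refl
lookup-△ (false ∷ p) (false ∷ q) zero = refl
lookup-△ (_ ∷ p) (_ ∷ q) (suc u) = lookup-△ p q u

xor-false⇒≡ : ∀ a b → a xor b ≡ false → a ≡ b
xor-false⇒≡ true  true  _ = refl
xor-false⇒≡ false false _ = refl

lookup-⁅⁆-≢ : u ≢ i → lookup ⁅ i ⁆ u ≡ outside
lookup-⁅⁆-≢ {u = u} {i = i} u≢i with lookup ⁅ i ⁆ u in eq
... | false = refl
... | true  = contradiction (x∈⁅y⁆⇒x≡y i (lookup⇒[]= u ⁅ i ⁆ eq)) u≢i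

lookup-pairˡ : (i j : Fin n) → lookup (⁅ i ⁆ ∪ ⁅ j ⁆) i ≡ inside
lookup-pairˡ i j rewrite lookup-zipWith _∨_ i ⁅ i ⁆ ⁅ j ⁆ | []=⇒lookup (x∈⁅x⁆ i) = refl

lookup-pairʳ : (i j : Fin n) → lookup (⁅ i ⁆ ∪ ⁅ j ⁆) j ≡ inside
lookup-pairʳ i j rewrite lookup-zipWith _∨_ j ⁅ i ⁆ ⁅ j ⁆ | []=⇒lookup (x∈⁅x⁆ j) = ∨-zeroʳ _

lookup-pair-≢ : u ≢ i → u ≢ j → lookup (⁅ i ⁆ ∪ ⁅ j ⁆) u ≡ outside
lookup-pair-≢ {u = u} {i = i} {j = j} u≢i u≢j
  rewrite lookup-zipWith _∨_ u ⁅ i ⁆ ⁅ j ⁆ | lookup-⁅⁆-≢ u≢i | lookup-⁅⁆-≢ u≢j = refl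

lookup-≢ : (p : Subset n) → lookup p x ≡ inside → lookup p y ≡ outside → x ≢ y
lookup-≢ p px py refl with () ← trans (sym px) py

∣insert∣ : (p : Subset n) (x : Fin n) → lookup p x ≡ outside → ∣ p [ x ]≔ inside ∣ ≡ suc ∣ p ∣
∣insert∣ (false ∷ p) zero    _  = refl
∣insert∣ (true  ∷ p) (suc x) px = cong suc (∣insert∣ p x px)
∣insert∣ (false ∷ p) (suc x) px = ∣insert∣ p x px

∣remove∣ : (p : Subset n) (x : Fin n) → lookup p x ≡ inside → suc ∣ p [ x ]≔ outside ∣ ≡ ∣ p ∣
∣remove∣ (true  ∷ p) zero    _  = refl
∣remove∣ (true  ∷ p) (suc x) px = cong suc (∣remove∣ p x px)
∣remove∣ (false ∷ p) (suc x) px = ∣remove∣ p x px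

-- Cardinality bounds as injections into a subset

nth : (p : Subset n) → Fin ∣ p ∣ → Fin n
nth (true  ∷ p) zero    = zero
nth (true  ∷ p) (suc t) = suc (nth p t)
nth (false ∷ p) t       = suc (nth p t)

lookup-nth : (p : Subset n) (t : Fin ∣ p ∣) → lookup p (nth p t) ≡ inside
lookup-nth (true  ∷ p) zero    = refl
lookup-nth (true  ∷ p) (suc t) = lookup-nth p t
lookup-nth (false ∷ p) t       = lookup-nth p t

nth-injective : (p : Subset n) → Injective _≡_ _≡_ (nth p)
nth-injective (true  ∷ p) {zero}  {zero}  _  = refl
nth-injective (true  ∷ p) {suc s} {suc t} eq = cong suc (nth-injective p (suc-injective eq))
nth-injective (false ∷ p) eq = nth-injective p (suc-injective eq)

rank : x ∈ p → Fin ∣ p ∣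
rank here = zero
rank (there {y = true}  x∈p) = suc (rank x∈p)
rank (there {y = false} x∈p) = rank x∈p

rank-injective : (x∈p : x ∈ p) (y∈p : y ∈ p) → rank x∈p ≡ rank y∈p → x ≡ y
rank-injective here here _ = refl
rank-injective here (there {y = true} _) ()
rank-injective (there {y = true} _) here ()
rank-injective (there {y = true}  x∈p) (there y∈p) eq =
  cong suc (rank-injective x∈p y∈p (suc-injective eq))
rank-injective (there {y = false} x∈p) (there y∈p) eq = cong suc (rank-injective x∈p y∈p eq)

InjectionInto : ℕ → Subset n → Set
InjectionInto {n} m p = Σ[ f ∈ (Fin m → Fin n) ] Injective _≡_ _≡_ f × (∀ t → lookup p (f t) ≡ inside)

-- Together with `injection⇒≤∣p∣`, this trades the bound in `Admissible` for distinct elements that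
-- can be carried one by one from one graph to the other.
≤∣p∣⇒injection : m ≤ ∣ p ∣ → InjectionInto m p
≤∣p∣⇒injection {m = m} {p = p} m≤ = f , f-inj , λ t → lookup-nth p (inject≤ t m≤)
  where
  f : Fin m → Fin _
  f t = nth p (inject≤ t m≤)

  f-inj : Injective _≡_ _≡_ f
  f-inj eq = inject≤-injective m≤ m≤ _ _ (nth-injective p eq)

injection⇒≤∣p∣ : InjectionInto m p → m ≤ ∣ p ∣
injection⇒≤∣p∣ {p = p} (f , f-inj , f∈p) = injective⇒≤
  {f = λ t → rank (∈p t)} (λ {s} {t} eq → f-inj (rank-injective (∈p s) (∈p t) eq))
  where
  ∈p : ∀ t → f t ∈ p
  ∈p t = lookup⇒[]= (f t) p (f∈p t)

-- Token moves

-- B = A − i + j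
record Move (A B : Subset n) (i j : Fin n) : Set where
  constructor move
  field
    i∈A  : lookup A i ≡ inside
    i∉B  : lookup B i ≡ outside
    j∉A  : lookup A j ≡ outside
    j∈B  : lookup B j ≡ inside
    stay : ∀ {u} → u ≢ i → u ≢ j → lookup A u ≡ lookup B u

open Move

Move-sym : Move A B i j → Move B A j i
Move-sym (move i∈A i∉B j∉A j∈B stay) = move j∈B j∉A i∉B i∈A (λ u≢j u≢i → sym (stay u≢i u≢j))

Move-≢ : Move A B i j → i ≢ j
Move-≢ {A = A} μ = lookup-≢ A (i∈A μ) (j∉A μ)

Move-functional : Move A B i j → Move A D i j → B ≡ D
Move-functional {A = A} {B = B} {i = i} {j = j} {D = D} μ ν = lookup-ext eq
  where
  eq : ∀ u → lookup B u ≡ lookup D u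
  eq u with u ≟ i | u ≟ j
  ... | yes refl | _        = trans (i∉B μ) (sym (i∉B ν))
  ... | no _     | yes refl = trans (j∈B μ) (sym (j∈B ν))
  ... | no u≢i   | no u≢j   = trans (sym (stay μ u≢i u≢j)) (stay ν u≢i u≢j)

-- Away from `i` and `j` the sets agree, and `u` is not `j` because `j` lies outside `A`. Hence `A`
-- and `B` determine the endpoints of the move.
Move-source : Move A B i j → lookup A u ≡ inside → lookup B u ≡ outside → u ≡ i
Move-source {A = A} {B = B} {i = i} {j = j} {u = u} μ u∈A u∉B with u ≟ i
... | yes u≡i = u≡i
... | no  u≢i with () ← trans (sym u∈A) (trans (stay μ u≢i (lookup-≢ A u∈A (j∉A μ))) u∉B)

Move-target : Move A B i j → lookup A u ≡ outside → lookup B u ≡ inside → u ≡ j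
Move-target μ u∉A u∈B = Move-source (Move-sym μ) u∈B u∉A

-- Position `y` is empty in `A`, filled in `D` and vacated again in `B`, so it drops out of the
-- composite.
Move-via-target : Move A D x y → Move D B y z → x ≢ z → Move A B x z
Move-via-target {A = A} {D = D} {x = x} {y = y} {B = B} {z = z} μ ν x≢z = move
  (i∈A μ)
  (trans (sym (stay ν (Move-≢ μ) x≢z)) (i∉B μ))
  (trans (stay μ (≢-sym x≢z) (≢-sym (Move-≢ ν))) (j∉A ν))
  (j∈B ν)
  stay′
  where
  stay′ : ∀ {u} → u ≢ x → u ≢ z → lookup A u ≡ lookup B u
  stay′ {u} u≢x u≢z with u ≟ y
  ... | yes refl = trans (j∉A μ) (sym (i∉B ν))
  ... | no  u≢y  = trans (stay μ u≢x u≢y) (stay ν u≢y u≢z)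

-- Dual case: `x` is occupied in `A`, vacated in `D` and refilled from `w` in `B`.
Move-via-source : Move A D x y → Move D B w x → y ≢ w → Move A B w y
Move-via-source {A = A} {D = D} {x = x} {y = y} {B = B} {w = w} μ ν y≢w = move
  (trans (stay μ (Move-≢ ν) (≢-sym y≢w)) (i∈A ν))
  (i∉B ν)
  (j∉A μ)
  (trans (sym (stay ν y≢w (≢-sym (Move-≢ μ)))) (j∈B μ))
  stay′
  where
  stay′ : ∀ {u} → u ≢ w → u ≢ y → lookup A u ≡ lookup B u
  stay′ {u} u≢w u≢y with u ≟ x
  ... | yes refl = trans (i∈A μ) (sym (j∈B ν))
  ... | no  u≢x  = trans (stay μ u≢x u≢y) (stay ν u≢w u≢x)

Move-exists : (A : Subset n) → lookup A x ≡ inside → lookup A y ≡ outside →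
  ∃[ D ] Move A D x y × ∣ D ∣ ≡ ∣ A ∣
Move-exists {x = x} {y = y} A x∈A y∉A = A-x+y , μ , trans (∣insert∣ A-x y y∉A-x) (∣remove∣ A x x∈A)
  where
  A-x   = A [ x ]≔ outside
  A-x+y = A-x [ y ]≔ inside

  x≢y : x ≢ y
  x≢y = lookup-≢ A x∈A y∉A

  y∉A-x : lookup A-x y ≡ outside
  y∉A-x = trans (lookup∘update′ (≢-sym x≢y) A outside) y∉A

  μ : Move A A-x+y x y
  μ = move x∈A
    (trans (lookup∘update′ x≢y A-x inside) (lookup∘update x A outside))
    y∉A
    (lookup∘update y A-x inside)
    (λ u≢x u≢y → sym (trans (lookup∘update′ u≢y A-x inside) (lookup∘update′ u≢x A outside)))

Move⇒△ : Move A B i j → A △ B ≡ ⁅ i ⁆ ∪ ⁅ j ⁆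
Move⇒△ {A = A} {B = B} {i = i} {j = j} μ =
  lookup-ext (λ u → trans (lookup-△ A B u) (eq u))
  where
  eq : ∀ u → lookup A u xor lookup B u ≡ lookup (⁅ i ⁆ ∪ ⁅ j ⁆) u
  eq u with u ≟ i | u ≟ j
  ... | yes refl | _        = trans (cong₂ _xor_ (i∈A μ) (i∉B μ)) (sym (lookup-pairˡ i j))
  ... | no _     | yes refl = trans (cong₂ _xor_ (j∉A μ) (j∈B μ)) (sym (lookup-pairʳ i j))
  ... | no u≢i   | no u≢j   = trans (cong (_xor lookup B u) (stay μ u≢i u≢j))
    (trans (xor-same (lookup B u)) (sym (lookup-pair-≢ u≢i u≢j)))

-- The sets can differ only at `i` and `j`, both absent from `B`, so `B` is contained in `A`; the
-- inclusion is proper at `i`.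
two-lost⇒∣B∣<∣A∣ : (A B : Subset n) → lookup A i ≡ inside → lookup B i ≡ outside → lookup B j ≡ outside →
  (∀ {u} → u ≢ i → u ≢ j → lookup A u ≡ lookup B u) → ∣ B ∣ < ∣ A ∣
two-lost⇒∣B∣<∣A∣ {i = i} A B i∈A i∉B j∉B stay = p⊂q⇒∣p∣<∣q∣ {p = B} {q = A}
  ( (λ {u} u∈B → let Bu = []=⇒lookup u∈B in
       lookup⇒[]= u A (trans (stay (lookup-≢ B Bu i∉B) (lookup-≢ B Bu j∉B)) Bu))
  , i , lookup⇒[]= i A i∈A , λ i∈B → lookup-≢ B ([]=⇒lookup i∈B) i∉B refl )

-- The symmetric difference would also allow `i` and `j` to lie in the same set; equal cardinality
-- forces one to leave and the other to enter.
△⇒Move : ∣ A ∣ ≡ ∣ B ∣ → A △ B ≡ ⁅ i ⁆ ∪ ⁅ j ⁆ → Move A B i j ⊎ Move A B j i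
△⇒Move {A = A} {B = B} {i = i} {j = j} ∣A∣≡∣B∣ A△B≡ = cases refl refl refl refl
  where
  xor≡ : ∀ u → lookup A u xor lookup B u ≡ lookup (⁅ i ⁆ ∪ ⁅ j ⁆) u
  xor≡ u = trans (sym (lookup-△ A B u)) (cong (λ p → lookup p u) A△B≡)

  stay′ : ∀ {u} → u ≢ i → u ≢ j → lookup A u ≡ lookup B u
  stay′ {u} u≢i u≢j = xor-false⇒≡ _ _ (trans (xor≡ u) (lookup-pair-≢ u≢i u≢j))

  xorᵢ : lookup A i xor lookup B i ≡ true
  xorᵢ = trans (xor≡ i) (lookup-pairˡ i j)

  xorⱼ : lookup A j xor lookup B j ≡ true
  xorⱼ = trans (xor≡ j) (lookup-pairʳ i j)

  cases : ∀ {a b c d} → lookup A i ≡ a → lookup B i ≡ b → lookup A j ≡ c → lookup B j ≡ d →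
    Move A B i j ⊎ Move A B j i
  -- The first four clauses contradict the symmetric difference at `i` or at `j`, the last two
  -- contradict equal cardinality.
  cases {true}  {true}  Ai Bi Aj Bj with () ← trans (sym xorᵢ) (cong₂ _xor_ Ai Bi)
  cases {false} {false} Ai Bi Aj Bj with () ← trans (sym xorᵢ) (cong₂ _xor_ Ai Bi)
  cases {c = true}  {true}  Ai Bi Aj Bj with () ← trans (sym xorⱼ) (cong₂ _xor_ Aj Bj)
  cases {c = false} {false} Ai Bi Aj Bj with () ← trans (sym xorⱼ) (cong₂ _xor_ Aj Bj)
  cases {true}  {false} {false} {true}  Ai Bi Aj Bj = inj₁ (move Ai Bi Aj Bj stay′)
  cases {false} {true}  {true}  {false} Ai Bi Aj Bj =
    inj₂ (move Aj Bj Ai Bi (λ u≢j u≢i → stay′ u≢i u≢j))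
  cases {true}  {false} {true}  {false} Ai Bi Aj Bj =
    contradiction (two-lost⇒∣B∣<∣A∣ A B Ai Bi Bj stay′) (<-irrefl (sym ∣A∣≡∣B∣))
  cases {false} {true}  {false} {true}  Ai Bi Aj Bj =
    contradiction (two-lost⇒∣B∣<∣A∣ B A Bi Ai Aj (λ u≢i u≢j → sym (stay′ u≢i u≢j))) (<-irrefl ∣A∣≡∣B∣)

-- Common neighbours of two sets of tokens

-- A ∖ B = {x , w} and B ∖ A = {y , z}
record Far (A B : Subset n) (x y z w : Fin n) : Set where
  field
    x≢w  : x ≢ w
    y≢z  : y ≢ z
    x∈A  : lookup A x ≡ inside
    x∉B  : lookup B x ≡ outside
    y∉A  : lookup A y ≡ outside
    y∈B  : lookup B y ≡ inside
    z∉A  : lookup A z ≡ outside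
    z∈B  : lookup B z ≡ inside
    w∈A  : lookup A w ≡ inside
    w∉B  : lookup B w ≡ outside
    rest : ∀ {u} → u ≢ x → u ≢ y → u ≢ z → u ≢ w → lookup A u ≡ lookup B u

data Meeting (A B : Subset n) (x y z w : Fin n) : Set where
  same-source : x ≡ z → Move A B w y → Meeting A B x y z w
  same-target : y ≡ w → Move A B x z → Meeting A B x y z w
  far         : Far A B x y z w → Meeting A B x y z w

-- Compare sources and targets of the two moves. If both agree, undoing the move from `D` gives
-- `A ≡ B`; if exactly one agrees, passing through `D` composes to a single move from `A` to `B`.
meeting : A ≢ B → Move A D x y → Move B D z w → Meeting A B x y z w
meeting {A = A} {B = B} {D = D} {x = x} {y = y} {z = z} {w = w} A≢B μ ν with x ≟ z | y ≟ w
... | yes refl | yes refl = contradiction (Move-functional (Move-sym μ) (Move-sym ν)) A≢B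
... | yes refl | no y≢w   = same-source refl (Move-via-source μ (Move-sym ν) y≢w)
... | no x≢z   | yes refl = same-target refl (Move-via-target μ (Move-sym ν) x≢z)
... | no x≢z   | no y≢w   = far record
  { x≢w  = ≢-sym w≢x
  ; y≢z  = y≢z
  ; x∈A  = i∈A μ
  ; x∉B  = trans (stay ν x≢z (≢-sym w≢x)) (i∉B μ)
  ; y∉A  = j∉A μ
  ; y∈B  = trans (stay ν y≢z y≢w) (j∈B μ)
  ; z∉A  = trans (stay μ (≢-sym x≢z) (≢-sym y≢z)) (i∉B ν)
  ; z∈B  = i∈A ν
  ; w∈A  = trans (stay μ w≢x (≢-sym y≢w)) (j∈B ν)
  ; w∉B  = j∉A ν
  ; rest = λ u≢x u≢y u≢z u≢w → trans (stay μ u≢x u≢y) (sym (stay ν u≢z u≢w))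
  }
  where
  -- Both inequalities are read off from `D`: it contains `w` and `y` but neither `x` nor `z`.
  w≢x : w ≢ x
  w≢x = lookup-≢ D (j∈B ν) (i∉B μ)
  y≢z : y ≢ z
  y≢z = lookup-≢ D (j∈B μ) (i∉B ν)

-- A move loses only one element, whereas `x` and `w` are both lost.
Far⇒¬Move : Far A B x y z w → ¬ Move A B i j
Far⇒¬Move φ μ = x≢w (trans (Move-source μ x∈A x∉B) (sym (Move-source μ w∈A w∉B)))
  where open Far φ

Meets : Subset n → Subset n → Subset n → Set
Meets A B D = (∃[ x ] ∃[ y ] Move A D x y) × (∃[ z ] ∃[ w ] Move B D z w)

module _ (φ : Far A B x y z w) where
  open Far φ

  loss gain : Fin 2 → Fin _
  loss zero       = x
  loss (suc zero) = w
  gain zero       = y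
  gain (suc zero) = z

  loss-surjective : lookup A u ≡ inside → lookup B u ≡ outside → ∃[ a ] loss a ≡ u
  loss-surjective {u} u∈A u∉B with u ≟ x | u ≟ w
  ... | yes refl | _        = zero , refl
  ... | no _     | yes refl = suc zero , refl
  ... | no u≢x   | no u≢w with () ← trans (sym u∈A) (trans
    (rest u≢x (lookup-≢ A u∈A y∉A) (lookup-≢ A u∈A z∉A) u≢w) u∉B)

  gain-surjective : lookup A u ≡ outside → lookup B u ≡ inside → ∃[ b ] gain b ≡ u
  gain-surjective {u} u∉A u∈B with u ≟ y | u ≟ z
  ... | yes refl | _        = zero , refl
  ... | no _     | yes refl = suc zero , refl
  ... | no u≢y   | no u≢z with () ← trans (sym u∈B) (trans
    (sym (rest (lookup-≢ B u∈B x∉B) u≢y u≢z (lookup-≢ B u∈B w∉B))) u∉A)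

  Far-meets : Meets A B D → ∃[ a ] ∃[ b ] Move A D (loss a) (gain b)
  Far-meets ((x′ , y′ , μ) , (z′ , w′ , ν)) with meeting (λ { refl → lookup-≢ A x∈A x∉B refl }) μ ν
  -- The first two outcomes would join `A` to `B` by a single move. In the third, `ψ` places the
  -- source of `μ` in `A ∖ B` and its target in `B ∖ A`.
  ... | same-source _ ρ = contradiction ρ (Far⇒¬Move φ)
  ... | same-target _ ρ = contradiction ρ (Far⇒¬Move φ)
  ... | far ψ with a , refl ← loss-surjective (Far.x∈A ψ) (Far.x∉B ψ)
                 | b , refl ← gain-surjective (Far.y∉A ψ) (Far.y∈B ψ) = a , b , μ

  Far⇒collision : (f : Fin 5 → Subset _) → (∀ t → Meets A B (f t)) →
    ∃[ s ] ∃[ t ] s ≢ t × f s ≡ f t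
  -- A common neighbour is coded by its pair of choices in `Fin 2`, giving 2 · 2 = 4 codes; `≤-refl`
  -- proves 4 < 5.
  Far⇒collision f meets with pigeonhole ≤-refl code
    where
    code : Fin 5 → Fin 4
    code t = let a , b , _ = Far-meets (meets t) in combine a b
  ... | s , t , s<t , eq =
    let a , b , μ = Far-meets (meets s)
        c , d , ν = Far-meets (meets t)
        a≡c , b≡d = combine-injective a b c d eq
    in s , t , <⇒≢ s<t
     , Move-functional (subst₂ (λ a b → Move A (f s) (loss a) (gain b)) a≡c b≡d μ) ν

5-meetings⇒Move : A ≢ B → (f : Fin 5 → Subset n) → Injective _≡_ _≡_ f →
  (∀ t → Meets A B (f t)) → ∃[ i ] ∃[ j ] Move A B i j
5-meetings⇒Move {A = A} {B = B} A≢B f f-inj meets = cases (meeting A≢B μ ν)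
  where
  -- One common neighbour decides the kind of meeting; all five enter only to refute the `far` case.
  μ = proj₂ (proj₂ (proj₁ (meets zero)))
  ν = proj₂ (proj₂ (proj₂ (meets zero)))

  cases : Meeting A B x y z w → ∃[ i ] ∃[ j ] Move A B i j
  cases (same-source _ ρ) = _ , _ , ρ
  cases (same-target _ ρ) = _ , _ , ρ
  cases (far φ) = let _ , _ , s≢t , eq = Far⇒collision φ f meets in contradiction (f-inj eq) s≢t

-- D arises from A by moving a token from i to j with a stop at v, whether or not v
-- is occupied.
Via : Subset n → Fin n → Fin n → Fin n → Subset n → Set
Via A i j v D = Move A D v j ⊎ Move A D i v

-- Membership of `v` in `A` decides which alternative holds, so the mixed cases are impossible.
Via-functional : Via A i j v D → Via A i j v D′ → D ≡ D′
Via-functional (inj₁ μ) (inj₁ ν) = Move-functional μ ν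
Via-functional (inj₂ μ) (inj₂ ν) = Move-functional μ ν
Via-functional {A = A} (inj₁ μ) (inj₂ ν) = contradiction refl (lookup-≢ A (i∈A μ) (j∉A ν))
Via-functional {A = A} (inj₂ μ) (inj₁ ν) = contradiction refl (lookup-≢ A (i∈A ν) (j∉A μ))

-- The stop is recovered as the element leaving or entering `A`. In a mixed case the leaving element
-- is also `i`, so a stop would equal `i`.
Via-injective : u ≢ i → v ≢ i → Via A i j u D → Via A i j v D → u ≡ v
Via-injective _   _   (inj₁ μ) (inj₁ ν) = Move-source ν (i∈A μ) (i∉B μ)
Via-injective _   _   (inj₂ μ) (inj₂ ν) = Move-target ν (j∉A μ) (j∈B μ)
Via-injective u≢i _   (inj₁ μ) (inj₂ ν) = contradiction (Move-source ν (i∈A μ) (i∉B μ)) u≢i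
Via-injective _   v≢i (inj₂ μ) (inj₁ ν) = contradiction (Move-source μ (i∈A ν) (i∉B ν)) v≢i

Via-exists : (A : Subset n) → lookup A i ≡ inside → lookup A j ≡ outside → (v : Fin n) →
  ∃[ D ] Via A i j v D × ∣ D ∣ ≡ ∣ A ∣
Via-exists A Ai Aj v with lookup A v in Av
... | true  with D , μ , eq ← Move-exists A Av Aj = D , inj₁ μ , eq
... | false with D , μ , eq ← Move-exists A Ai Av = D , inj₂ μ , eq

-- Graphs

module _ {X : FinSet} where
  open FinSet X using (Carrier; elem; enum; size)

  elem-injective : Injective _≡_ _≡_ elem
  elem-injective = Injection.injective (↔⇒↣ (↔-sym enum))

  index : Carrier → Fin size
  index = Inverse.to enum

  index-injective : Injective _≡_ _≡_ index
  index-injective = Injection.injective (↔⇒↣ enum)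

  elem-index : ∀ c → elem (index c) ≡ c
  elem-index = Inverse.strictlyInverseʳ enum

  module _ (G : Graph X) where
    open Graph G

    CommonNeighbours : ℕ → Carrier → Carrier → Set
    CommonNeighbours m a b = Σ[ f ∈ (Fin m → Carrier) ]
      Injective _≡_ _≡_ f × (∀ t → a ~ f t × b ~ f t)

    ~⇒≢ : ∀ {i j} → elem i ~ elem j → i ≢ j
    ~⇒≢ i~j refl = ~-irrefl i~j

    lookup-N∩N : ∀ a b i → lookup (N a ∩ N b) i ≡ does (a ~? elem i) ∧ does (b ~? elem i)
    lookup-N∩N a b i = trans (lookup-zipWith _∧_ i (N a) (N b))
      (cong₂ _∧_ (lookup∘tabulate _ i) (lookup∘tabulate _ i))

    ∈N∩N⇒~ : ∀ a b i → lookup (N a ∩ N b) i ≡ inside → a ~ elem i × b ~ elem i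
    ∈N∩N⇒~ a b i eq with a ~? elem i | b ~? elem i | trans (sym (lookup-N∩N a b i)) eq
    ... | yes a~i | yes b~i | _ = a~i , b~i
    ... | yes _   | no _    | ()
    ... | no _    | _       | ()

    ~⇒∈N∩N : ∀ a b i → a ~ elem i → b ~ elem i → lookup (N a ∩ N b) i ≡ inside
    ~⇒∈N∩N a b i a~i b~i = trans (lookup-N∩N a b i)
      (cong₂ _∧_ (dec-true (a ~? elem i) a~i) (dec-true (b ~? elem i) b~i))

    ≤∣N∩N∣⇒CommonNeighbours : ∀ {m} a b → m ≤ ∣ N a ∩ N b ∣ → CommonNeighbours m a b
    ≤∣N∩N∣⇒CommonNeighbours a b m≤ =
      let f , f-inj , f∈ = ≤∣p∣⇒injection {p = N a ∩ N b} m≤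
      in elem ∘ f , f-inj ∘ elem-injective , λ t → ∈N∩N⇒~ a b (f t) (f∈ t)

    CommonNeighbours⇒≤∣N∩N∣ : ∀ {m} a b → CommonNeighbours m a b → m ≤ ∣ N a ∩ N b ∣
    CommonNeighbours⇒≤∣N∩N∣ a b (f , f-inj , f~) = injection⇒≤∣p∣ {p = N a ∩ N b}
      ( index ∘ f
      , f-inj ∘ index-injective
      , λ t → ~⇒∈N∩N a b (index (f t))
          (subst (a ~_) (sym (elem-index (f t))) (proj₁ (f~ t)))
          (subst (b ~_) (sym (elem-index (f t))) (proj₂ (f~ t))) )

    -- Token adjacency with a direction: `IsEdge` does not record which endpoint carries the token.
    Slide : Subset size → Subset size → Set
    Slide A B = ∃[ i ] ∃[ j ] elem i ~ elem j × Move A B i j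

    edge⇒Slide : ∣ A ∣ ≡ ∣ B ∣ → IsEdge (A △ B) → Slide A B
    edge⇒Slide eq (i , j , i~j , A△B≡) with △⇒Move eq A△B≡
    ... | inj₁ μ = i , j , i~j , μ
    ... | inj₂ μ = j , i , ~-sym i~j , μ

    Slide⇒edge : Slide A B → IsEdge (A △ B)
    Slide⇒edge (i , j , i~j , μ) = i , j , i~j , Move⇒△ μ

    slides⇒Meets : Slide A D → Slide B D → Meets A B D
    slides⇒Meets (x , y , _ , μ) (z , w , _ , ν) = (x , y , μ) , (z , w , ν)

    -- When sources or targets agree, the composite through `D` must be `ρ` itself. This identifies
    -- its endpoints with `i` and `j`, and the shared position is the stop.
    slides⇒Via : Move A B i j → Slide A D → Slide B D →
      ∃[ v ] elem i ~ elem v × elem j ~ elem v × Via A i j v D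
    slides⇒Via {A = A} ρ (x , y , x~y , μ) (z , w , z~w , ν)
      with meeting (λ { refl → lookup-≢ A (i∈A ρ) (i∉B ρ) refl }) μ ν
    ... | same-source refl σ
      with refl ← Move-source ρ (i∈A σ) (i∉B σ) | refl ← Move-target ρ (j∉A σ) (j∈B σ) =
      x , ~-sym z~w , ~-sym x~y , inj₁ μ
    ... | same-target refl σ
      with refl ← Move-source ρ (i∈A σ) (i∉B σ) | refl ← Move-target ρ (j∉A σ) (j∈B σ) =
      y , x~y , z~w , inj₂ μ
    ... | far φ = contradiction ρ (Far⇒¬Move φ)

    -- The slide from `B` reverses the composite of `D` back to `A` with `ρ`. Irreflexivity
    -- separates `v` from `i` and `j`, as composing requires.
    Via⇒slides : Move A B i j → elem i ~ elem v → elem j ~ elem v → Via A i j v D →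
      Slide A D × Slide B D
    Via⇒slides ρ i~v j~v (inj₁ μ) =
      (_ , _ , ~-sym j~v , μ) ,
      (_ , _ , ~-sym i~v , Move-sym (Move-via-source (Move-sym μ) ρ (≢-sym (~⇒≢ i~v))))
    Via⇒slides ρ i~v j~v (inj₂ μ) =
      (_ , _ , i~v , μ) ,
      (_ , _ , j~v , Move-sym (Move-via-target (Move-sym μ) ρ (≢-sym (~⇒≢ j~v))))

-- Transfer of common neighbours between `G` and `F k G`

module _ {X : FinSet} (G : Graph X) (k : ℕ) where
  open FinSet X using (elem; size)
  open Graph G using (_~_)
  open Graph (F k G) using () renaming (_~_ to _~ᶠ_)

  ~ᶠ⇒Slide : ∀ (A B : KSub size k) → A ~ᶠ B → Slide G (proj₁ A) (proj₁ B)
  ~ᶠ⇒Slide (A , ∣A∣) (B , ∣B∣) = edge⇒Slide G (trans ∣A∣ (sym ∣B∣))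

  -- Send each common neighbour to its stop; `Via-functional` keeps distinct ones apart.
  CommonNeighbours-F⁻ : ∀ {A B : KSub size k} {i j} → Move (proj₁ A) (proj₁ B) i j →
    CommonNeighbours (F k G) m A B → CommonNeighbours G m (elem i) (elem j)
  CommonNeighbours-F⁻ {m = m} {A} {B} {i} {j} ρ (f , f-inj , f~) =
    elem ∘ stop , stop-inj , λ t → proj₁ (proj₂ (via t)) , proj₁ (proj₂ (proj₂ (via t)))
    where
    via : ∀ t → ∃[ v ] elem i ~ elem v × elem j ~ elem v × Via (proj₁ A) i j v (proj₁ (f t))
    via t = slides⇒Via G ρ (~ᶠ⇒Slide A (f t) (proj₁ (f~ t))) (~ᶠ⇒Slide B (f t) (proj₂ (f~ t)))

    stop : Fin m → Fin size
    stop t = proj₁ (via t)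

    stop-inj : Injective _≡_ _≡_ (elem ∘ stop)
    stop-inj {s} {t} eq = f-inj (KSub-≡ (Via-functional
      (proj₂ (proj₂ (proj₂ (via s))))
      (subst (λ v → Via _ i j v _) (sym (elem-injective {X} eq)) (proj₂ (proj₂ (proj₂ (via t)))))))

  -- Send each vertex to the token set obtained by stopping there; `Via-injective` keeps distinct
  -- ones apart.
  CommonNeighbours-F⁺ : ∀ {A B : KSub size k} {i j} → Move (proj₁ A) (proj₁ B) i j →
    CommonNeighbours G m (elem i) (elem j) → CommonNeighbours (F k G) m A B
  CommonNeighbours-F⁺ {m = m} {A} {B} {i} {j} ρ (f , f-inj , f~) = E , E-inj , λ t →
    let sA , sB = Via⇒slides G ρ (i~v t) (j~v t) (proj₁ (proj₂ (via t)))
    in Slide⇒edge G sA , Slide⇒edge G sB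
    where
    stop : Fin m → Fin size
    stop t = index {X} (f t)

    i~v : ∀ t → elem i ~ elem (stop t)
    i~v t = subst (elem i ~_) (sym (elem-index {X} (f t))) (proj₁ (f~ t))

    j~v : ∀ t → elem j ~ elem (stop t)
    j~v t = subst (elem j ~_) (sym (elem-index {X} (f t))) (proj₂ (f~ t))

    via : ∀ t → ∃[ D ] Via (proj₁ A) i j (stop t) D × ∣ D ∣ ≡ ∣ proj₁ A ∣
    via t = Via-exists (proj₁ A) (i∈A ρ) (j∉A ρ) (stop t)

    E : Fin m → KSub size k
    E t = proj₁ (via t) , trans (proj₂ (proj₂ (via t))) (proj₂ A)

    E-inj : Injective _≡_ _≡_ E
    E-inj {s} {t} eq = f-inj (index-injective {X} (Via-injective
      (≢-sym (~⇒≢ G (i~v s))) (≢-sym (~⇒≢ G (i~v t)))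
      (subst (Via _ i j (stop s)) (cong proj₁ eq) (proj₁ (proj₂ (via s))))
      (proj₁ (proj₂ (via t)))))

-- The two inclusions of edge sets

lemma1 : (X : FinSet) (G : Graph X) (k : ℕ) → 1 ≤ k → k < FinSet.size X → C (F k G) ≗ᴳ F k (C G)
lemma1 X G k _ _ A B = mk⇔ to from
  where
  open FinSet X using (elem)

  to : Graph._~_ (C (F k G)) A B → Graph._~_ (F k (C G)) A B
  to (inj₁ (i , j , i~j , eq)) = i , j , inj₁ i~j , eq
  to (inj₂ (A≢B , 5≤)) =
    -- The five common neighbours serve twice: they force a single move from `i` to `j`, and their
    -- stops make that pair admissible in `G`.
    let common@(f , f-inj , f~) = ≤∣N∩N∣⇒CommonNeighbours (F k G) A B 5≤
        i , j , ρ = 5-meetings⇒Move (A≢B ∘ KSub-≡) (proj₁ ∘ f) (f-inj ∘ KSub-≡) λ t →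
          slides⇒Meets G (~ᶠ⇒Slide G k A (f t) (proj₁ (f~ t))) (~ᶠ⇒Slide G k B (f t) (proj₂ (f~ t)))
    in Slide⇒edge (C G)
      ( i , j
      , inj₂ ( Move-≢ ρ ∘ elem-injective {X}
             , CommonNeighbours⇒≤∣N∩N∣ G (elem i) (elem j) (CommonNeighbours-F⁻ G k {A = A} {B} ρ common))
      , ρ )

  from : Graph._~_ (F k (C G)) A B → Graph._~_ (C (F k G)) A B
  -- Decoding over `C G` gives a move along either an edge or an admissible pair of `G`.
  from e with ~ᶠ⇒Slide (C G) k A B e
  ... | i , j , inj₁ i~j , ρ = inj₁ (Slide⇒edge G (i , j , i~j , ρ))
  ... | i , j , inj₂ (_ , 5≤) , ρ = inj₂
    ( (λ { refl → lookup-≢ (proj₁ A) (i∈A ρ) (i∉B ρ) refl })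
    , CommonNeighbours⇒≤∣N∩N∣ (F k G) A B
        (CommonNeighbours-F⁺ G k {A = A} {B} ρ (≤∣N∩N∣⇒CommonNeighbours G (elem i) (elem j) 5≤)) )
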